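{- Let $\Delta$ be a simplicial complex on a finite set of vertices $V=\{v_1,v_2,\ldots,v_n\}$, and let $P\subseteq \mathbb{Z}_{\ge 0}^n$ be the set of $\mathcal{P}$-positions of nim on $\Delta$. Let $G=(g_1,g_2,\ldots,g_n)$ be a collection of positions of impartial games. Then the simplicial emperor sum $\Delta(G)$ is a $\mathcal{P}$-position if and only if $(\mathrm{Pl}(g_1),\mathrm{Pl}(g_2),\ldots,\mathrm{Pl}(g_n))\in P$ and $g_i$ is a $\mathcal{P}$-position for every $i\in\{1,\ldots,n\}$.
   Context: Games: All games are two-player perfect-information games without chance moves, and are impartial (both players have the same set of options at each position). They are played under the normal play convention (the player who makes the last move wins, so a player unable to move loses). They are loop-free (a position occurs at most once in a play), and every play ends after finitely many moves. An option of a position $g$ is a position reached by one move from $g$. A strict follower of $g$ is a position reached from $g$ by one or more successive moves, where consecutive moves are counted without regard to which player makes them. A terminal position is one with no options. A position is a $\mathcal{P}$-position if the previous player (the one not about to move) has a winning strategy, and an $\mathcal{N}$-position if the next player (the one about to move) has a winning strategy. Each position is exactly one of the two. Simplicial complex: A simplicial complex $\Delta$ on a finite set $V$ is a subset of $2^V$ such that $\{v\}\in\Delta$ for every $v\in V$, and if $F\in\Delta$ and $F'\subseteq F$ then $F'\in\Delta$. Elements of $\Delta$ are called faces. Nim on $\Delta$: A position is a tuple $(a_1,\ldots,a_n)$ of non-negative integers, with $a_i$ the number of stones on vertex $v_i$. A move consists of choosing a non-empty face $F\in\Delta$ and removing a positive number of stones from each vertex in $F$ (the numbers may be chosen independently for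 the different vertices of $F$), leaving all vertices not in $F$ unchanged. So the options of $(a_1,\ldots,a_n)$ are the tuples $(a_1',\ldots,a_n')$ of non-negative integers for which there is a non-empty face $F$ with $a_i'<a_i$ for all $v_i\in F$ and $a_i'=a_i$ for all $v_i\notin F$. Normal play is used. Simplicial emperor sum: For a collection $G=(g_1,\ldots,g_n)$ of positions of impartial games, $\Delta(G)$ is the position in which $g_i$ is placed on vertex $v_i$. The player to move chooses a face $F\in\Delta$ and makes an arbitrary number of successive moves (possibly zero) in the position on each vertex of $F$. In addition, in the position on each vertex not in $F$, the player makes at most one move. At least one move must be made in total. So the options of $\Delta(G)$ are the positions $\Delta(g_1',\ldots,g_n')$ with $(g_1',\ldots,g_n')\neq(g_1,\ldots,g_n)$ for which there is a face $F\in\Delta$ such that $g_i'$ is equal to $g_i$ or a strict follower of $g_i$ for each $v_i\in F$, and $g_i'$ is equal to $g_i$ or an option of $g_i$ for each $v_i\notin F$. Normal play is used. $\mathcal{P}$-position length: For a position $g$ of an impartial game, $\mathrm{Pl}(g)=0$ if $g$ is terminal, and otherwise $\mathrm{Pl}(g)=\max\{\mathrm{Pl}(g') : g' \text{ is a } \mathcal{P}\text{ -position and a strict follower of } g\}+1$. It is assumed that these maxima exist, so that $\mathrm{Pl}$ is a well-defined non-negative integer (this is automatic if each position has only finitely many strict followers). -}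

module Defs where

open import Axiom.ExcludedMiddle using (ExcludedMiddle)
open import Data.Fin using (Fin)
open import Data.Fin.Subset using (Subset; _∈_; _∉_; _⊆_; ⁅_⁆; Nonempty)
open import Data.Nat using (ℕ; suc; _≤_; _<_)
open import Data.Product using (_×_; _,_; ∃; ∃-syntax)
open import Data.Sum using (_⊎_; inj₁; inj₂)
open import Data.Vec.Functional using (Vector)
open import Function using (flip)
open import Induction.WellFounded using (WellFounded; Acc; acc)
open import Level using (Level; 0ℓ; _⊔_) renaming (suc to lsuc)
open import Relation.Binary using (Rel)
open import Relation.Binary.Construct.Closure.Transitive using (TransClosure)
open import Relation.Binary.PropositionalEquality using (_≡_)
open import Relation.Nullary using (¬_; yes; no; contradiction)
open import Relation.Unary using (Pred; Decidable)

private
  variable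
    a ℓ : Level

-- Throughout, g ⟶ g′ means that g′ is an option of g.
module _ {Pos : Set a} (_⟶_ : Rel Pos ℓ) where

  Terminal : Pred Pos (a ⊔ ℓ)
  Terminal g = ∀ g′ → ¬ (g ⟶ g′)

  -- Elements of IsP g (resp. IsN g) are winning strategies, under normal
  -- play, for the previous (resp. next) player at g.
  mutual
    data IsP (g : Pos) : Set (a ⊔ ℓ) where
      allN : (∀ g′ → g ⟶ g′ → IsN g′) → IsP g

    data IsN (g : Pos) : Set (a ⊔ ℓ) where
      someP : ∀ g′ → g ⟶ g′ → IsP g′ → IsN g

  Determined : Set (a ⊔ ℓ)
  Determined = ∀ g → IsP g ⊎ IsN g

  -- Classically, determinacy follows from termination.
  excludedMiddle⇒determined :
    ExcludedMiddle (a ⊔ ℓ) → WellFounded (flip _⟶_) → Determined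
  excludedMiddle⇒determined em wf g = go g (wf g)
    where
    go : ∀ g → Acc (flip _⟶_) g → IsP g ⊎ IsN g
    go g (acc rs) with em {IsN g}
    ... | yes n = inj₂ n
    ... | no ¬n = inj₁ (allN λ g′ m → helper g′ m (go g′ (rs m)))
      where
      helper : ∀ g′ → g ⟶ g′ → IsP g′ ⊎ IsN g′ → IsN g′
      helper g′ m (inj₁ p) = contradiction (someP g′ m p) ¬n
      helper g′ m (inj₂ n) = n

-- Determinacy is a field because, for games with infinitely many options,
-- it is not constructively derivable from well-foundedness; see
-- excludedMiddle⇒determined.
record Game a ℓ : Set (lsuc (a ⊔ ℓ)) where
  infix 4 _⟶_
  field
    Pos         : Set a
    _⟶_         : Rel Pos ℓ
    wellFounded : WellFounded (flip _⟶_)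
    determined  : Determined _⟶_

  StrictFollower : Rel Pos (a ⊔ ℓ)
  StrictFollower g g′ = TransClosure _⟶_ g g′

  IsPPosition : Pred Pos (a ⊔ ℓ)
  IsPPosition = IsP _⟶_

open Game public using (Pos)

IsMaximum : Pred ℕ ℓ → ℕ → Set ℓ
IsMaximum S m = S m × (∀ k → S k → k ≤ m)

-- IsPl G pl says that pl satisfies the recursive equations defining the
-- P-position length on G, in particular that all the maxima involved exist.
-- As G is well-founded, there is at most one such pl up to pointwise equality.
record IsPl (G : Game a ℓ) (pl : Pos G → ℕ) : Set (a ⊔ ℓ) where
  open Game G using (_⟶_; StrictFollower; IsPPosition)
  field
    terminal    : ∀ g → Terminal _⟶_ g → pl g ≡ 0
    nonTerminal : ∀ g → ¬ Terminal _⟶_ g →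
      ∃[ m ] IsMaximum
               (λ k → ∃[ g′ ] IsPPosition g′ × StrictFollower g g′ × pl g′ ≡ k)
               m
           × pl g ≡ suc m

-- The vertex set is Fin n.
record SimplicialComplex (n : ℕ) : Set₁ where
  field
    Face       : Pred (Subset n) 0ℓ
    face?      : Decidable Face
    singleton  : ∀ v → Face ⁅ v ⁆
    downClosed : ∀ {F F′} → Face F → F′ ⊆ F → Face F′

module _ {n : ℕ} (Δ : SimplicialComplex n) where
  open SimplicialComplex Δ using (Face)

  NimMove : Rel (Vector ℕ n) 0ℓ
  NimMove x x′ = ∃[ F ] Face F × Nonempty F
    × (∀ i → i ∈ F → x′ i < x i)
    × (∀ i → i ∉ F → x′ i ≡ x i)

  EmperorMove : (G : Fin n → Game a ℓ) → Rel (∀ i → Pos (G i)) (a ⊔ ℓ)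
  EmperorMove G g g′ = ¬ (∀ i → g′ i ≡ g i)
    × (∃[ F ] Face F
       × (∀ i → i ∈ F → g′ i ≡ g i ⊎ Game.StrictFollower (G i) (g i) (g′ i))
       × (∀ i → i ∉ F → g′ i ≡ g i ⊎ Game._⟶_ (G i) (g i) (g′ i)))

{-# OPTIONS --safe #-}
module Submission where

-- If g i is a P-position, its P-position followers realise exactly the
-- P-position lengths below Pl (g i), and no option of it is a P-position.  So
-- among tuples of P-positions ("good" when Pl (g) is moreover a nim
-- P-position) the emperor moves are the nim moves on Pl.  From an arbitrary
-- tuple, the single free move turns each N-component into a P-position; a
-- winning nim move, if one is needed, is then made on top of this by extending
-- the play on the vertices of its face.  Hence each tuple is good or has a good
-- option, while no good tuple has a good option.

open import Defs
open import Algebra.Properties.Monoid.Sum using (sum)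
open import Data.Fin using (Fin; zero; suc)
open import Data.Fin.Properties using (all?)
open import Data.Fin.Subset using (Subset; _∈_; _∉_; _⊆_; ⊥)
open import Data.Fin.Subset.Properties using (_∈?_; anySubset?; nonempty?; ⊥⊆; ∉⊥)
open import Data.List using (List; []; [_]; upTo; allFin; cartesianProductWith)
open import Data.List.Membership.Propositional using () renaming (_∈_ to _∈ˡ_)
open import Data.List.Membership.Propositional.Properties
  using (∈-allFin; ∈-upTo⁺; ∈-cartesianProductWith⁺)
open import Data.List.Relation.Unary.All as All using ()
open import Data.List.Relation.Unary.Any as Any using (here)
open import Data.Nat using (ℕ; zero; suc; _≤_; _<_; s≤s; _<?_)
import Data.Nat.Properties as ℕ
open import Data.Nat.Induction using (<-wellFounded)
open import Data.Product using (_×_; _,_; ∃; ∃-syntax; proj₁; proj₂)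
open import Data.Sum as Sum using (_⊎_; inj₁; inj₂; [_,_]′)
open import Data.Vec as Vec using (Vec; []; _∷_)
open import Data.Vec.Functional using (Vector)
open import Data.Vec.Properties using (lookup∘tabulate; lookup⇒[]=; []=⇒lookup)
open import Data.Vec.Relation.Binary.Pointwise.Inductive as Pointwise
  using (Pointwise; []; _∷_)
open import Function using (_∘_)
open import Function.Bundles using (_⇔_; mk⇔)
open import Induction.WellFounded using (Acc; acc)
open import Level using (Level)
open import Relation.Binary using (Rel)
import Relation.Binary.Construct.Closure.Transitive as Plus
open import Relation.Binary.PropositionalEquality
  using (_≡_; refl; sym; trans; cong; subst; subst₂; _≗_)
open import Relation.Nullary using (¬_; Dec; yes; no; does; contradiction)
open import Relation.Nullary.Decidable
  using (_×-dec_; _→-dec_; ¬?; dec-true; dec-false)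
open import Relation.Unary using (Pred; Decidable)

private
  variable
    a ℓ p q : Level
    n : ℕ

-- Finite search, boxes of vectors and sums.

∀⊎∃-∈ : {X : Set a} {P : Pred X p} {Q : Pred X q} (xs : List X) →
  (∀ x → P x ⊎ Q x) → (∀ {x} → x ∈ˡ xs → P x) ⊎ ∃ Q
∀⊎∃-∈ xs p∪q = Sum.map All.lookup Any.satisfied (All.decide p∪q xs)

-- Two covering predicates stand in for a decidable one: equality of positions need not be
-- decidable, but at each vertex the alternative "equal or moved" comes as a disjunction.
∀⊎∃ : {P : Pred (Fin n) p} {Q : Pred (Fin n) q} →
  (∀ i → P i ⊎ Q i) → (∀ i → P i) ⊎ ∃ Q
∀⊎∃ {n = n} p∪q = Sum.map₁ (λ f i → f (∈-allFin i)) (∀⊎∃-∈ (allFin n) p∪q)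

-- Nim positions are functions, so their options are listed only up to `≗`: the box below a
-- tabulated position contains the tabulation of each of its options.
downset : Vec ℕ n → List (Vec ℕ n)
downset []       = [ [] ]
downset (b ∷ bs) = cartesianProductWith _∷_ (upTo (suc b)) (downset bs)

∈-downset : {xs bs : Vec ℕ n} → Pointwise _≤_ xs bs → xs ∈ˡ downset bs
∈-downset []           = here refl
∈-downset (x≤b ∷ xs≤bs) =
  ∈-cartesianProductWith⁺ _∷_ (∈-upTo⁺ (s≤s x≤b)) (∈-downset xs≤bs)

total : Vector ℕ n → ℕ
total = sum ℕ.+-0-monoid

total-mono-≤ : {x y : Vector ℕ n} → (∀ i → x i ≤ y i) → total x ≤ total y
total-mono-≤ {zero}  x≤y = ℕ.≤-refl
total-mono-≤ {suc n} x≤y = ℕ.+-mono-≤ (x≤y zero) (total-mono-≤ (x≤y ∘ suc))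

total-mono-< : {x y : Vector ℕ n} → (∀ i → x i ≤ y i) →
  ∀ i → x i < y i → total x < total y
total-mono-< x≤y zero    x<y = ℕ.+-mono-<-≤ x<y (total-mono-≤ (x≤y ∘ suc))
total-mono-< x≤y (suc i) x<y =
  ℕ.+-mono-≤-< (x≤y zero) (total-mono-< (x≤y ∘ suc) i x<y)

module _ {P : Pred (Fin n) p} (P? : Decidable P) where

  ⁅_⁆? : Subset n
  ⁅_⁆? = Vec.tabulate (does ∘ P?)

  ∈-⁅⁆? : ∀ {i} → P i → i ∈ ⁅_⁆?
  ∈-⁅⁆? {i} pi =
    lookup⇒[]= i _ (trans (lookup∘tabulate _ i) (dec-true (P? i) pi))

  ∈-⁅⁆?⁻ : ∀ {i} → i ∈ ⁅_⁆? → P i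
  ∈-⁅⁆?⁻ {i} i∈ with P? i in eq
  ... | yes pi = pi
  ... | no  _  with trans (sym (trans (lookup∘tabulate _ i) (cong does eq)))
                          ([]=⇒lookup i∈)
  ... | ()

module _ {X : Set a} (_⟶_ : Rel X ℓ) where

  -- The two strategies are played against each other; both are inductive data, so the play descends
  -- structurally.
  IsP⇒¬IsN : ∀ {g} → IsP _⟶_ g → ¬ IsN _⟶_ g
  IsP⇒¬IsN (allN f) (someP g′ m p) with f g′ m
  ... | n = IsP⇒¬IsN p n

-- Nim on a simplicial complex.

module _ (Δ : SimplicialComplex n) where
  open SimplicialComplex Δ

  nimMove? : ∀ x x′ → Dec (NimMove Δ x x′)
  nimMove? x x′ = anySubset? λ F → face? F ×-dec nonempty? F
    ×-dec all? (λ i → (i ∈? F) →-dec (x′ i <? x i))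
    ×-dec all? (λ i → ¬? (i ∈? F) →-dec (x′ i ℕ.≟ x i))

  NimMove-≤ : ∀ {x x′} → NimMove Δ x x′ → ∀ i → x′ i ≤ x i
  NimMove-≤ (F , _ , _ , lt , eq) i with i ∈? F
  ... | yes i∈F = ℕ.<⇒≤ (lt i i∈F)
  ... | no  i∉F = ℕ.≤-reflexive (eq i i∉F)

  NimMove-total : ∀ {x x′} → NimMove Δ x x′ → total x′ < total x
  NimMove-total m@(F , _ , (i , i∈F) , lt , _) =
    total-mono-< (NimMove-≤ m) i (lt i i∈F)

  NimMove-resp-≗ : ∀ {x y x′ y′} → x ≗ y → x′ ≗ y′ →
    NimMove Δ x x′ → NimMove Δ y y′
  NimMove-resp-≗ x≗y x′≗y′ (F , f , ne , lt , eq) = F , f , ne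
    , (λ i i∈F → subst₂ _<_ (x′≗y′ i) (x≗y i) (lt i i∈F))
    , (λ i i∉F → trans (sym (x′≗y′ i)) (trans (eq i i∉F) (x≗y i)))

  nimIsP-resp-≗ : ∀ {x y} → x ≗ y → IsP (NimMove Δ) x → IsP (NimMove Δ) y
  nimIsP-resp-≗ x≗y (allN f) =
    allN λ y′ m → f y′ (NimMove-resp-≗ (sym ∘ x≗y) (λ _ → refl) m)

  nimIsN-resp-≗ : ∀ {x y} → x ≗ y → IsN (NimMove Δ) x → IsN (NimMove Δ) y
  nimIsN-resp-≗ x≗y (someP x′ m px′) =
    someP x′ (NimMove-resp-≗ x≗y (λ _ → refl) m) px′

  -- An emperor move may leave vertices of its face untouched, a nim move may not. The strictly
  -- decreased vertices form a subset of `F`, hence a face by down-closure.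
  nimMove-within : ∀ {x x′ F} → Face F →
    (∀ i → x′ i ≡ x i ⊎ (i ∈ F × x′ i < x i)) → (∃[ i ] x′ i < x i) →
    NimMove Δ x x′
  nimMove-within {x} {x′} {F} face step (j , j<) =
    M , downClosed face M⊆F , (j , ∈-⁅⁆? moved? j<)
    , (λ i → ∈-⁅⁆?⁻ moved?) , unmoved
    where
    moved? : Decidable (λ i → x′ i < x i)
    moved? i = x′ i <? x i

    M : Subset n
    M = ⁅ moved? ⁆?

    M⊆F : M ⊆ F
    M⊆F {i} i∈M with step i
    ... | inj₁ eq        = contradiction eq (ℕ.<⇒≢ (∈-⁅⁆?⁻ moved? i∈M))
    ... | inj₂ (i∈F , _) = i∈F

    unmoved : ∀ i → i ∉ M → x′ i ≡ x i
    unmoved i i∉M with step i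
    ... | inj₁ eq       = eq
    ... | inj₂ (_ , lt) = contradiction (∈-⁅⁆? moved? lt) i∉M

  -- Retrograde analysis: every move lowers `total`, and the options lie in a finite box, so a
  -- winning option can be searched for.
  nim-determined : Determined (NimMove Δ)
  nim-determined x = go x (<-wellFounded (total x))
    where
    go : ∀ x → Acc _<_ (total x) → IsP (NimMove Δ) x ⊎ IsN (NimMove Δ) x
    go x (acc rs) = Sum.map toP toN (∀⊎∃-∈ (downset (Vec.tabulate x)) option)
      where
      -- Vectors of the box that are not options satisfy the left alternative vacuously.
      option : ∀ v → (NimMove Δ x (Vec.lookup v) → IsN (NimMove Δ) (Vec.lookup v))
        ⊎ (NimMove Δ x (Vec.lookup v) × IsP (NimMove Δ) (Vec.lookup v))
      option v with nimMove? x (Vec.lookup v)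
      ... | no ¬m = inj₁ λ m → contradiction m ¬m
      ... | yes m with go (Vec.lookup v) (rs (NimMove-total m))
      ...   | inj₁ pv = inj₂ (m , pv)
      ...   | inj₂ nv = inj₁ λ _ → nv

      toP : (∀ {v} → v ∈ˡ downset (Vec.tabulate x) →
        NimMove Δ x (Vec.lookup v) → IsN (NimMove Δ) (Vec.lookup v)) →
        IsP (NimMove Δ) x
      toP f = allN λ x′ m → nimIsN-resp-≗ (lookup∘tabulate x′)
        (f (∈-downset (Pointwise.tabulate⁺ (NimMove-≤ m)))
           (NimMove-resp-≗ (λ _ → refl) (sym ∘ lookup∘tabulate x′) m))

      toN : ∃ (λ v → NimMove Δ x (Vec.lookup v) × IsP (NimMove Δ) (Vec.lookup v)) →
        IsN (NimMove Δ) x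
      toN (v , m , pv) = someP (Vec.lookup v) m pv

-- P-position length in a single game.

module _ {G : Game a ℓ} {pl : Pos G → ℕ} (isPl : IsPl G pl) where
  open Game G
  open IsPl isPl

  pl-follower-< : ∀ {g h} → StrictFollower g h → IsPPosition h → pl h < pl g
  pl-follower-< {g} {h} g⟶⁺h ph with nonTerminal g (nonTerm g⟶⁺h)
    where
    nonTerm : ∀ {g} → StrictFollower g h → ¬ Terminal _⟶_ g
    nonTerm Plus.[ m ]   t = t _ m
    nonTerm (m Plus.∷ _) t = t _ m
  ... | m , (_ , max) , eq =
    subst (pl h <_) (sym eq) (s≤s (max (pl h) (h , ph , g⟶⁺h , refl)))

  -- The maximum defining `pl g` is attained at a P-position `g′` with `pl g′` one less than `pl g`.
  -- Either `k` is that value, or it lies below it and is found among the followers of `g′`.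
  pl-attained : ∀ {g k} → k < pl g →
    ∃[ h ] IsPPosition h × StrictFollower g h × pl h ≡ k
  pl-attained {g} = go g (<-wellFounded (pl g))
    where
    go : ∀ g → Acc _<_ (pl g) → ∀ {k} → k < pl g →
      ∃[ h ] IsPPosition h × StrictFollower g h × pl h ≡ k
    go g (acc rs) {k} k<
      with nonTerminal g (λ t → ℕ.m<n⇒n≢0 k< (terminal g t))
    ... | m , ((g′ , pg′ , g⟶⁺g′ , eq′) , _) , eq
      with ℕ.m≤n⇒m<n∨m≡n (ℕ.≤-pred (subst (k <_) eq k<))
    ... | inj₂ refl = g′ , pg′ , g⟶⁺g′ , eq′
    ... | inj₁ k<m  =
      let h , ph , g′⟶⁺h , eqh =
            go g′ (rs (pl-follower-< g⟶⁺g′ pg′)) (subst (k <_) (sym eq′) k<m)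
      in h , ph , g⟶⁺g′ Plus.++ g′⟶⁺h , eqh

  P-withinOption : ∀ g → ∃[ h ] IsPPosition h × (h ≡ g ⊎ g ⟶ h)
  P-withinOption g with determined g
  ... | inj₁ pg             = g , pg , inj₁ refl
  ... | inj₂ (someP h m ph) = h , ph , inj₂ m

-- Good positions of the emperor sum.

module _ (Δ : SimplicialComplex n) (G : Fin n → Game a ℓ)
  (pl : ∀ i → Pos (G i) → ℕ) (isPl : ∀ i → IsPl (G i) (pl i)) where
  open SimplicialComplex Δ

  private
    Position : Set a
    Position = ∀ i → Pos (G i)

    infix 4 _⇒_
    _⇒_ : Rel Position _
    _⇒_ = EmperorMove Δ G

    Pl : Position → Vector ℕ n
    Pl g i = pl i (g i)

    AllP : Pred Position _
    AllP g = ∀ i → Game.IsPPosition (G i) (g i)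

    Good : Pred Position _
    Good g = IsP (NimMove Δ) (Pl g) × AllP g

  emperor-follower : ∀ {g h} → g ⇒ h →
    ∀ i → h i ≡ g i ⊎ Game.StrictFollower (G i) (g i) (h i)
  emperor-follower (_ , F , _ , inF , outF) i with i ∈? F
  ... | yes i∈F = inF i i∈F
  ... | no  i∉F = Sum.map₂ Plus.[_] (outF i i∉F)

  -- Turns the negative condition that the tuple changes into a concrete vertex at which a move was
  -- made.
  emperor-moved : ∀ {g h} → g ⇒ h →
    ∃[ i ] Game.StrictFollower (G i) (g i) (h i)
  emperor-moved m@(h≢g , _) with ∀⊎∃ (emperor-follower m)
  ... | inj₁ h≡g = contradiction h≡g h≢g
  ... | inj₂ i⟶⁺ = i⟶⁺

  emperor⇒nim : ∀ {g h} → AllP g → AllP h → g ⇒ h → NimMove Δ (Pl g) (Pl h)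
  emperor⇒nim {g} {h} pg ph m@(_ , F , face , inF , outF) =
    nimMove-within Δ face step
      (let i , g⟶⁺h = emperor-moved m in i , pl-follower-< (isPl i) g⟶⁺h (ph i))
    where
    step : ∀ i → Pl h i ≡ Pl g i ⊎ (i ∈ F × Pl h i < Pl g i)
    step i with i ∈? F
    ... | yes i∈F = Sum.map (cong (pl i))
      (λ g⟶⁺h → i∈F , pl-follower-< (isPl i) g⟶⁺h (ph i)) (inF i i∈F)
    ... | no  i∉F with outF i i∉F | pg i
    ...   | inj₁ eq  | _      = inj₁ (cong (pl i) eq)
    -- Off the face only one move is possible, and one move from a P-position ends in an N-position,
    -- whereas `h i` is a P-position.
    ...   | inj₂ g⟶h | allN f =
      contradiction (f (h i) g⟶h) (IsP⇒¬IsN (Game._⟶_ (G i)) (ph i))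

  -- The positions are told apart by `pl`, which drops strictly at `i`.
  moved-≢ : ∀ {g h : Position} → AllP h → ∀ i → Game.StrictFollower (G i) (g i) (h i) →
    ¬ (∀ j → h j ≡ g j)
  moved-≢ {g} {h} ph i g⟶⁺h h≡g =
    ℕ.<⇒≢ (pl-follower-< (isPl i) g⟶⁺h (ph i)) (cong (pl i) (h≡g i))

  good⊎goodOption : ∀ g → Good g ⊎ ∃[ h ] g ⇒ h × Good h
  good⊎goodOption g
    with nim-determined Δ (λ i → pl i (proj₁ (P-withinOption (isPl i) (g i))))
  good⊎goodOption g | inj₁ nimP
    with ∀⊎∃ (λ i → proj₂ (proj₂ (P-withinOption (isPl i) (g i))))
  ... | inj₁ h≡g = inj₁
    ( nimIsP-resp-≗ Δ (λ i → cong (pl i) (h≡g i)) nimP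
    , λ i → subst (Game.IsPPosition (G i)) (h≡g i)
              (proj₁ (proj₂ (P-withinOption (isPl i) (g i)))) )
  ... | inj₂ (i , g⟶h) = inj₂ (h
    , ( moved-≢ {g} {h} ph i Plus.[ g⟶h ]
      -- Only free moves are made, so the empty face suffices; it is a face because it lies below
      -- the singleton of the moved vertex.
      , ⊥ , downClosed (singleton i) ⊥⊆
      , (λ j j∈⊥ → contradiction j∈⊥ ∉⊥)
      , (λ j _ → proj₂ (proj₂ (P-withinOption (isPl j) (g j)))) )
    , nimP , ph)
    where
    h : Position
    h j = proj₁ (P-withinOption (isPl j) (g j))
    ph : AllP h
    ph j = proj₁ (proj₂ (P-withinOption (isPl j) (g j)))
  good⊎goodOption g
    | inj₂ (someP y (F , face , (i , i∈F) , lt , eq) nimP) = inj₂ (h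
    , ( moved-≢ {g} {h} ph i (inF i i∈F)
      , F , face , (λ j j∈F → inj₂ (inF j j∈F)) , outF )
    , nimIsP-resp-≗ Δ (sym ∘ Pl-h) nimP , ph)
    where
    -- Off `F` the free move is kept. On `F` it is continued to a P-position whose length is the
    -- target `y j` of the winning nim move.
    extend : ∀ j → ∃[ h ] Game.IsPPosition (G j) h × pl j h ≡ y j
      × (j ∈ F → Game.StrictFollower (G j) (g j) h)
      × (j ∉ F → h ≡ g j ⊎ Game._⟶_ (G j) (g j) h)
    extend j with P-withinOption (isPl j) (g j) | lt j | eq j | j ∈? F
    ... | h , ph , g⟶?h | _    | eqj | no j∉F  =
      h , ph , sym (eqj j∉F) , (λ j∈F → contradiction j∈F j∉F) , λ _ → g⟶?h
    ... | h , ph , g⟶?h | ltj  | _   | yes j∈F with pl-attained (isPl j) (ltj j∈F)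
    ...   | k , pk , h⟶⁺k , eqk = k , pk , eqk
      -- If no free move was made, the play starts at `g j` itself; otherwise that move is
      -- prepended.
      , (λ _ → [ (λ { refl → h⟶⁺k }) , (Plus._∷ h⟶⁺k) ]′ g⟶?h)
      , λ j∉F → contradiction j∈F j∉F

    h : Position
    h j = proj₁ (extend j)
    ph : AllP h
    ph j = proj₁ (proj₂ (extend j))
    Pl-h : Pl h ≗ y
    Pl-h j = proj₁ (proj₂ (proj₂ (extend j)))
    inF : ∀ j → j ∈ F → Game.StrictFollower (G j) (g j) (h j)
    inF j = proj₁ (proj₂ (proj₂ (proj₂ (extend j))))
    outF : ∀ j → j ∉ F → h j ≡ g j ⊎ Game._⟶_ (G j) (g j) (h j)
    outF j = proj₂ (proj₂ (proj₂ (proj₂ (extend j))))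

  good-noGoodOption : ∀ {g h} → Good g → g ⇒ h → ¬ Good h
  good-noGoodOption (allN f , pg) m (nimPh , ph) =
    IsP⇒¬IsN (NimMove Δ) nimPh (f _ (emperor⇒nim pg ph m))

  -- Pl may increase at the first of the two moves, when it reaches an
  -- N-position.
  two-moves-total : ∀ {g g′ h} → g ⇒ g′ → g′ ⇒ h → AllP h →
    total (Pl h) < total (Pl g)
  two-moves-total {g} {g′} {h} m m′ ph =
    let i , g⟶⁺g′ = emperor-moved m
    in total-mono-< dec-≤ i (dec-< i g⟶⁺g′)
    where
    dec-< : ∀ i → Game.StrictFollower (G i) (g i) (g′ i) → Pl h i < Pl g i
    dec-< i g⟶⁺g′ = pl-follower-< (isPl i)
      ([ (λ eq → subst (Game.StrictFollower (G i) (g i)) (sym eq) g⟶⁺g′)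
       , (g⟶⁺g′ Plus.++_) ]′ (emperor-follower m′ i))
      (ph i)

    dec-≤ : ∀ i → Pl h i ≤ Pl g i
    dec-≤ i with emperor-follower m i | emperor-follower m′ i
    ... | inj₂ g⟶⁺g′ | _           = ℕ.<⇒≤ (dec-< i g⟶⁺g′)
    ... | inj₁ eq    | inj₁ eq′    = ℕ.≤-reflexive (cong (pl i) (trans eq′ eq))
    ... | inj₁ eq    | inj₂ g′⟶⁺h = subst (λ k → Pl h i ≤ pl i k) eq
      (ℕ.<⇒≤ (pl-follower-< (isPl i) g′⟶⁺h (ph i)))

  -- The winning strategy always returns to a good position: an option of a good position is not
  -- good, hence has a good option. The induction measures such pairs of moves by `total`.
  good⇒IsP : ∀ {g} → Good g → IsP _⇒_ g
  good⇒IsP {g} = go g (<-wellFounded (total (Pl g)))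
    where
    go : ∀ g → Acc _<_ (total (Pl g)) → Good g → IsP _⇒_ g
    go g (acc rs) good = allN option
      where
      option : ∀ g′ → g ⇒ g′ → IsN _⇒_ g′
      option g′ m with good⊎goodOption g′
      ... | inj₁ good′             = contradiction good′ (good-noGoodOption good m)
      ... | inj₂ (h , m′ , goodh) =
        someP h m′ (go h (rs (two-moves-total {h = h} m m′ (proj₂ goodh))) goodh)

  -- Otherwise there would be a good option, a P-position by `good⇒IsP`, making `g` an N-position.
  IsP⇒good : ∀ {g} → IsP _⇒_ g → Good g
  IsP⇒good {g} pg with good⊎goodOption g
  ... | inj₁ good            = good
  ... | inj₂ (h , m , goodh) =
    contradiction (someP h m (good⇒IsP goodh)) (IsP⇒¬IsN _⇒_ pg)

theorem2 : ∀ {a ℓ} {n : ℕ} (Δ : SimplicialComplex n)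
    (G : Fin n → Game a ℓ)
    (pl : ∀ i → Pos (G i) → ℕ) → (∀ i → IsPl (G i) (pl i)) →
    (g : ∀ i → Pos (G i)) →
    IsP (EmperorMove Δ G) g
    ⇔ (IsP (NimMove Δ) (λ i → pl i (g i)) × (∀ i → Game.IsPPosition (G i) (g i)))
theorem2 Δ G pl isPl g = mk⇔ (IsP⇒good Δ G pl isPl) (good⇒IsP Δ G pl isPl)
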